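{- For any positive integer $k$ there exists a finite tree $T_{(k)}$ such that $\tau(T_{(k)})-\gamma_t(T_{(k)})=k$.
   Context: A vertex cover of a graph $G=(V,E)$ is a set $X\subseteq V$ such that each edge is incident to at least one vertex of $X$; $\tau(G)$ is the minimum cardinality of a vertex cover of $G$. A total dominating set of $G$ is a dominating set $D\subseteq V$ such that the subgraph induced by $D$ has no isolated vertices (equivalently, every vertex of $G$ has a neighbor in $D$); $\gamma_t(G)$ is the minimum cardinality of a total dominating set of $G$ (defined for graphs without isolated vertices). -}

module Defs where

open import Data.Fin.Base using (Fin)
open import Data.Fin.Properties using (all?; any?)
open import Data.Fin.Subset using (Subset; _∈_; ∣_∣; ⊤)
open import Data.Fin.Subset.Properties using (_∈?_; ∈⊤; anySubset?)
open import Data.List.Base using (List; []; _∷_; length)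
open import Data.List.Relation.Unary.Unique.Propositional using (Unique)
open import Data.Nat.Base using (ℕ; _≤_; _<_; NonZero)
open import Data.Nat.Induction using (Acc; acc; <-wellFounded)
open import Data.Nat.Properties using (_<?_; ≮⇒≥)
open import Data.Product.Base using (∃; ∃-syntax; _×_; _,_; proj₁; proj₂)
open import Data.Sum.Base using (_⊎_; inj₁)
open import Level using (0ℓ)
open import Relation.Binary.Construct.Closure.ReflexiveTransitive using (Star; ε; _◅_)
open import Relation.Binary.Core using (Rel)
open import Relation.Binary.Definitions using (Symmetric) renaming (Decidable to Decidable₂)
open import Relation.Binary.PropositionalEquality.Core using (_≡_; refl)
open import Relation.Nullary using (¬_; yes; no)
open import Relation.Nullary.Decidable using (_×-dec_; _⊎-dec_; _→-dec_)
open import Relation.Unary using (Pred; Decidable)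

-- Finite simple graphs, with vertex set Fin order.

record Graph : Set₁ where
  infix 4 _~_ _~?_
  field
    order  : ℕ
    _~_    : Rel (Fin order) 0ℓ
    _~?_   : Decidable₂ _~_
    ~-sym  : Symmetric _~_
    ~-irrefl : ∀ {v} → ¬ (v ~ v)

  Vertex : Set
  Vertex = Fin order

  VertexSet : Set
  VertexSet = Subset order

  Walk : Rel Vertex 0ℓ
  Walk = Star _~_

  -- Both endpoints are included.
  vertices : ∀ {u v} → Walk u v → List Vertex
  vertices {u} ε        = u ∷ []
  vertices {u} (_ ◅ w)  = u ∷ vertices w

  -- A cycle is a path on at least three vertices, closed up by an edge
  -- between its endpoints.
  record Cycle : Set where
    field
      {start end} : Vertex
      path        : Walk start end
      distinct    : Unique (vertices path)
      long        : 3 ≤ length (vertices path)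
      closing     : end ~ start

  Connected : Set
  Connected = ∀ u v → Walk u v

  Acyclic : Set
  Acyclic = ¬ Cycle

  record IsTree : Set where
    field
      nonEmpty  : NonZero order
      connected : Connected
      acyclic   : Acyclic

  NoIsolatedVertices : Set
  NoIsolatedVertices = ∀ v → ∃[ u ] v ~ u

  IsVertexCover : Pred VertexSet 0ℓ
  IsVertexCover X = ∀ u v → u ~ v → u ∈ X ⊎ v ∈ X

  IsDominating : Pred VertexSet 0ℓ
  IsDominating D = ∀ v → v ∈ D ⊎ ∃[ u ] (u ∈ D × v ~ u)

  InducesNoIsolated : Pred VertexSet 0ℓ
  InducesNoIsolated D = ∀ v → v ∈ D → ∃[ u ] (u ∈ D × v ~ u)

  IsTotalDominating : Pred VertexSet 0ℓ
  IsTotalDominating D = IsDominating D × InducesNoIsolated D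

  isVertexCover? : Decidable IsVertexCover
  isVertexCover? X =
    all? λ u → all? λ v → (u ~? v) →-dec ((u ∈? X) ⊎-dec (v ∈? X))

  isTotalDominating? : Decidable IsTotalDominating
  isTotalDominating? D =
    (all? λ v → (v ∈? D) ⊎-dec neighbour? v) ×-dec
    (all? λ v → (v ∈? D) →-dec neighbour? v)
    where
    neighbour? : Decidable (λ v → ∃[ u ] (u ∈ D × v ~ u))
    neighbour? v = any? λ u → (u ∈? D) ×-dec (v ~? u)

IsMinimumCardinality : ∀ {n} → Pred (Subset n) 0ℓ → Pred ℕ 0ℓ
IsMinimumCardinality P m =
  (∃[ X ] (P X × ∣ X ∣ ≡ m)) × (∀ Y → P Y → m ≤ ∣ Y ∣)

minimumCardinality : ∀ {n} {P : Pred (Subset n) 0ℓ} →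
                     Decidable P → ∃ P → ∃ (IsMinimumCardinality P)
minimumCardinality {P = P} P? (X₀ , p₀) = descend X₀ p₀ (<-wellFounded ∣ X₀ ∣)
  where
  descend : ∀ X → P X → Acc _<_ ∣ X ∣ → ∃ (IsMinimumCardinality P)
  descend X p (acc smaller)
    with anySubset? (λ Y → P? Y ×-dec (∣ Y ∣ <? ∣ X ∣))
  ... | yes (Y , q , Y<X) = descend Y q (smaller Y<X)
  ... | no none = ∣ X ∣ , (X , p , refl) , λ Y q → ≮⇒≥ λ Y<X → none (Y , q , Y<X)

module _ (G : Graph) where
  open Graph G

  τ-minimum : ∃ (IsMinimumCardinality IsVertexCover)
  τ-minimum = minimumCardinality isVertexCover? (⊤ , λ _ _ _ → inj₁ ∈⊤)

  τ : ℕ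
  τ = proj₁ τ-minimum

  γₜ-minimum : NoIsolatedVertices → ∃ (IsMinimumCardinality IsTotalDominating)
  γₜ-minimum ni = minimumCardinality isTotalDominating?
    (⊤ , (λ _ → inj₁ ∈⊤) , λ v _ → proj₁ (ni v) , ∈⊤ , proj₂ (ni v))

  γₜ : NoIsolatedVertices → ℕ
  γₜ ni = proj₁ (γₜ-minimum ni)

{-# OPTIONS --safe #-}

-- The tree T k is a chain of k + 1 copies of the path x – u – v – y, where
-- consecutive copies are joined by a path u – b – a – u′.  The vertices u and v
-- of all copies support a leaf, so they lie in every total dominating set, and
-- together they form one: γₜ = 2 (k + 1).  The edges ux, vy and ba form
-- a perfect matching, so every vertex cover has at least 2 (k + 1) + k vertices,
-- and the vertices u, v and b attain this bound.
module Submission where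

open import Defs
open import Data.Empty using (⊥; ⊥-elim)
open import Data.Fin.Base as Fin using (Fin; zero; suc; _↑ʳ_)
open import Data.Fin.Induction using (<-wellFounded)
open import Data.Fin.Patterns
import Data.Fin.Properties as Fin
open import Data.Fin.Subset using (Side; inside; outside; Subset; _∈_; _⊆_; ∣_∣)
open import Data.Fin.Subset.Properties using (drop-there; p⊆q⇒∣p∣≤∣q∣)
open import Data.Integer.Base using (+_; _-_; _⊖_)
import Data.Integer.Properties as ℤ
open import Data.List.Base using (_∷_; length)
import Data.List.Membership.Propositional as List
open import Data.List.Relation.Unary.All using (_∷_; lookup)
import Data.List.Relation.Unary.Any as Any
open import Data.List.Relation.Unary.AllPairs using (_∷_)
open import Data.List.Relation.Unary.Unique.Propositional using (Unique)
open import Data.Nat.Base as ℕ using (ℕ; zero; suc; _<_; _+_; _*_; _∸_; z≤n; s≤s)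
import Data.Nat.Properties as ℕ
open import Data.Product.Base using (Σ-syntax; ∃-syntax; _×_; _,_; proj₁; proj₂)
open import Data.Sum.Base using (_⊎_; inj₁; inj₂; [_,_]; swap) renaming (map to map-⊎)
open import Data.Vec.Base using ([]; _∷_; here; there)
open import Function.Base using (_∘_; id)
open import Induction.WellFounded using (Acc; acc)
open import Level using (0ℓ)
open import Relation.Binary.Construct.Closure.ReflexiveTransitive
  using (ε; _◅_; _◅◅_; reverse)
open import Relation.Binary.Core using (Rel)
open import Relation.Binary.PropositionalEquality
  using (_≡_; _≢_; refl; sym; trans; cong; cong₂; subst; module ≡-Reasoning)
open import Relation.Nullary using (yes; no)
open import Relation.Nullary.Decidable using (_×-dec_; _⊎-dec_)
open import Relation.Unary using (Pred)

-- Forests given by parent functions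

-- Only strictly decreasing values of parent count as edges, so a fixed point
-- encodes a root and the graph is a forest whatever the function is.
module ParentGraph {n : ℕ} (parent : Fin n → Fin n) where

  infix 4 _▹_

  _▹_ : Rel (Fin n) 0ℓ
  v ▹ u = parent v ≡ u × u Fin.< v

  graph : Graph
  graph = record
    { order    = n
    ; _~_      = λ u v → u ▹ v ⊎ v ▹ u
    ; _~?_     = λ u v → ((parent u Fin.≟ v) ×-dec (v Fin.<? u))
                   ⊎-dec ((parent v Fin.≟ u) ×-dec (u Fin.<? v))
    ; ~-sym    = swap
    ; ~-irrefl = [ ℕ.<-irrefl refl ∘ proj₂ , ℕ.<-irrefl refl ∘ proj₂ ]
    }

  open Graph graph

  start∈vertices : ∀ {s e} (w : Walk s e) → s List.∈ vertices w
  start∈vertices ε       = Any.here refl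
  start∈vertices (_ ◅ _) = Any.here refl

  end∈vertices : ∀ {s e} (w : Walk s e) → e List.∈ vertices w
  end∈vertices ε       = Any.here refl
  end∈vertices (_ ◅ w) = Any.there (end∈vertices w)

  long-path-open : ∀ {s e} (w : Walk s e) → Unique (vertices w) →
                   2 ℕ.≤ length (vertices w) → s ≢ e
  long-path-open ε       _         (s≤s ())
  long-path-open (_ ◅ w) (s∉w ∷ _) _ s≡e = lookup s∉w (end∈vertices w) s≡e

  -- A path that has gone from a parent to a child can never go up again.
  descend : ∀ {s t e} → t ▹ s → (w : Walk t e) → Unique (s ∷ vertices w) →
            s Fin.< e × (t ≡ e ⊎ parent e List.∈ vertices w)
  descend (_ , s<t) ε _ = s<t , inj₁ refl
  descend (refl , _) (inj₁ (refl , _) ◅ w) ((_ ∷ s∉w) ∷ _) =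
    ⊥-elim (lookup s∉w (start∈vertices w) refl)
  descend (_ , s<t) (inj₂ t′▹t ◅ w) (_ ∷ unique) with descend t′▹t w unique
  ... | t<e , inj₁ refl = ℕ.<-trans s<t t<e , inj₂ (Any.here (proj₁ t′▹t))
  ... | t<e , inj₂ p∈w  = ℕ.<-trans s<t t<e , inj₂ (Any.there p∈w)

  -- Either every step goes up, so the indices decrease all the way to `e`, or `descend` applies
  -- from the first downward step onwards.
  arrive : ∀ {s e} (w : Walk s e) → Unique (vertices w) →
           e Fin.≤ s ⊎ parent e List.∈ vertices w
  arrive ε _ = inj₁ ℕ.≤-refl
  arrive (inj₁ (_ , t<s) ◅ w) (_ ∷ unique) =
    map-⊎ (λ e≤t → ℕ.≤-trans e≤t (ℕ.<⇒≤ t<s)) Any.there (arrive w unique)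
  arrive (inj₂ t▹s ◅ w) unique with proj₂ (descend t▹s w unique)
  ... | inj₁ refl = inj₂ (Any.here (proj₁ t▹s))
  ... | inj₂ p∈w  = inj₂ (Any.there p∈w)

  -- Split on the directions of the first step and of the closing edge. If `e` is the parent of `s`,
  -- a first step up reaches `e` too early, and a first step down forces `s` below `e`. If `s` is
  -- the parent of `e`, then `arrive` or `descend` finds `s` a second time on the path, unless the
  -- order is violated or the path is too short.
  not-closed : ∀ {s e} (w : Walk s e) → Unique (vertices w) →
               3 ℕ.≤ length (vertices w) → e ~ s → ⊥
  not-closed ε _ (s≤s ())
  not-closed (inj₁ (s→t , _) ◅ w) (_ ∷ unique) (s≤s long) (inj₂ (s→e , _)) =
    long-path-open w unique long (trans (sym s→t) s→e)
  not-closed (inj₂ t▹s ◅ w) unique _ (inj₂ (_ , e<s)) =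
    ℕ.<-asym e<s (proj₁ (descend t▹s w unique))
  not-closed (inj₁ (_ , t<s) ◅ w) (s∉w ∷ unique) _ (inj₁ (e→s , s<e))
    with arrive w unique
  ... | inj₁ e≤t = ℕ.<⇒≱ (ℕ.<-trans t<s s<e) e≤t
  ... | inj₂ p∈w = lookup s∉w p∈w (sym e→s)
  not-closed (inj₂ t▹s ◅ w) (s∉w ∷ unique) (s≤s long) (inj₁ (e→s , _))
    with proj₂ (descend t▹s w (s∉w ∷ unique))
  ... | inj₁ t≡e = long-path-open w unique long t≡e
  ... | inj₂ p∈w = lookup s∉w p∈w (sym e→s)

  acyclic : Acyclic
  acyclic c = not-closed path distinct long closing
    where open Cycle c

  connected : ∀ r → (∀ v → v ≢ r → parent v Fin.< v) → Connected
  connected r descending u v = toRoot u ◅◅ reverse swap (toRoot v)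
    where
    climb : ∀ v → Acc Fin._<_ v → Walk v r
    climb v (acc smaller) with v Fin.≟ r
    ... | yes refl = ε
    ... | no v≢r   = inj₁ (refl , p<v) ◅ climb (parent v) (smaller p<v)
      where p<v = descending v v≢r

    toRoot : ∀ v → Walk v r
    toRoot v = climb v (<-wellFounded v)

-- The tree `T k`

-- In each block of six vertices, the order is u, x, v, y, b, a; the last block
-- lacks b and a.
parent : ∀ k → Fin (4 + k * 6) → Fin (4 + k * 6)
parent k       0F = 0F
parent k       1F = 0F
parent k       2F = 0F
parent k       3F = 2F
parent (suc k) 4F = 0F
parent (suc k) 5F = 4F
parent (suc k) 6F = 5F
parent (suc k) (suc (suc (suc (suc (suc (suc (suc v))))))) = 6 ↑ʳ parent k (suc v)

parent-< : ∀ k v → v ≢ 0F → parent k v Fin.< v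
parent-< k       0F v≢0 = ⊥-elim (v≢0 refl)
parent-< k       1F _ = ℕ.≤-refl
parent-< k       2F _ = ℕ.m≤m+n 1 1
parent-< k       3F _ = ℕ.≤-refl
parent-< (suc k) 4F _ = ℕ.m≤m+n 1 3
parent-< (suc k) 5F _ = ℕ.≤-refl
parent-< (suc k) 6F _ = ℕ.≤-refl
parent-< (suc k) (suc (suc (suc (suc (suc (suc (suc v))))))) _ =
  s≤s (s≤s (s≤s (s≤s (s≤s (s≤s (parent-< k (suc v) λ ()))))))

open module Chain (k : ℕ) = ParentGraph (parent k) using (_▹_) renaming (graph to T)
open Graph

T-isTree : ∀ k → IsTree (T k)
T-isTree k = record
  { nonEmpty  = _
  ; connected = ParentGraph.connected (parent k) 0F (parent-< k)
  ; acyclic   = ParentGraph.acyclic (parent k)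
  }

child : ∀ k v → v ≢ 0F → _~_ (T k) v (parent k v)
child k v v≢0 = inj₁ (refl , parent-< k v v≢0)

shift-∈ : ∀ {n} {p : Subset n} {b₀ b₁ b₂ b₃ b₄ b₅} {i} → i ∈ p →
          6 ↑ʳ i ∈ b₀ ∷ b₁ ∷ b₂ ∷ b₃ ∷ b₄ ∷ b₅ ∷ p
shift-∈ = there ∘ there ∘ there ∘ there ∘ there ∘ there

unshift-∈ : ∀ {n} {p : Subset n} {b₀ b₁ b₂ b₃ b₄ b₅} {i} →
            6 ↑ʳ i ∈ b₀ ∷ b₁ ∷ b₂ ∷ b₃ ∷ b₄ ∷ b₅ ∷ p → i ∈ p
unshift-∈ = drop-there ∘ drop-there ∘ drop-there ∘ drop-there ∘ drop-there ∘ drop-there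

-- Prepending a block re-attaches only the root of the shorter chain, and that root is the child in
-- no edge, so every old edge survives.
shift-▹ : ∀ k {v u} → _▹_ k v u → _▹_ (suc k) (6 ↑ʳ v) (6 ↑ʳ u)
shift-▹ k {zero}  (_ , ())
shift-▹ k {suc v} (v→u , u<v) =
  cong (6 ↑ʳ_) v→u , s≤s (s≤s (s≤s (s≤s (s≤s (s≤s u<v)))))

shift-~ : ∀ k {v u} → _~_ (T k) v u → _~_ (T (suc k)) (6 ↑ʳ v) (6 ↑ʳ u)
shift-~ k = map-⊎ (shift-▹ k) (shift-▹ k)

-- The extremal sets

-- The vertices u and v of all blocks, and also the vertices b if the side is inside.
blocks : Side → ∀ k → Subset (4 + k * 6)
blocks b zero    = inside ∷ outside ∷ inside ∷ outside ∷ []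
blocks b (suc k) = inside ∷ outside ∷ inside ∷ outside ∷ b ∷ outside ∷ blocks b k

u∈blocks : ∀ b k → 0F ∈ blocks b k
u∈blocks b zero    = here
u∈blocks b (suc k) = here

v∈blocks : ∀ b k → 2F ∈ blocks b k
v∈blocks b zero    = there (there here)
v∈blocks b (suc k) = there (there here)

cover : ∀ k → Subset (4 + k * 6)
cover = blocks inside

supports : ∀ k → Subset (4 + k * 6)
supports = blocks outside

∣cover∣ : ∀ k → ∣ cover k ∣ ≡ 2 + k * 3
∣cover∣ zero    = refl
∣cover∣ (suc k) = cong (λ n → 3 + n) (∣cover∣ k)

∣supports∣ : ∀ k → ∣ supports k ∣ ≡ 2 + k * 2
∣supports∣ zero    = refl
∣supports∣ (suc k) = cong (λ n → 2 + n) (∣supports∣ k)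

-- The vertex cover number

-- Every edge joins a non-root vertex to its parent, so a cover can be checked with one case per
-- vertex instead of one per pair.
CoversParents : ∀ k → Pred (Subset (4 + k * 6)) 0ℓ
CoversParents k X = ∀ v → v ≢ 0F → v ∈ X ⊎ parent k v ∈ X

coversParents⇒isVertexCover : ∀ k {X} → CoversParents k X → IsVertexCover (T k) X
coversParents⇒isVertexCover k {X} covers u v = [ edge , swap ∘ edge ]
  where
  edge : ∀ {v u} → _▹_ k v u → v ∈ X ⊎ u ∈ X
  edge {v} (v→u , u<v) =
    subst (λ w → v ∈ X ⊎ w ∈ X) v→u (covers v λ { refl → ℕ.n≮0 u<v })

isVertexCover⇒coversParents : ∀ k {X} → IsVertexCover (T k) X → CoversParents k X
isVertexCover⇒coversParents k covers v v≢0 = covers v (parent k v) (child k v v≢0)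

cover-coversParents : ∀ k → CoversParents k (cover k)
cover-coversParents k       0F _ = inj₁ (u∈blocks inside k)
cover-coversParents k       1F _ = inj₂ (u∈blocks inside k)
cover-coversParents k       2F _ = inj₂ (u∈blocks inside k)
cover-coversParents k       3F _ = inj₂ (v∈blocks inside k)
cover-coversParents (suc k) 4F _ = inj₂ (u∈blocks inside (suc k))
cover-coversParents (suc k) 5F _ = inj₂ (there (there (there (there here))))
cover-coversParents (suc k) 6F _ = inj₁ (shift-∈ (u∈blocks inside k))
cover-coversParents (suc k) (suc (suc (suc (suc (suc (suc (suc v))))))) _ =
  map-⊎ shift-∈ shift-∈ (cover-coversParents k (suc v) λ ())

-- Meant for a matching edge on the first two positions: covering it costs one vertex beyond those
-- counted in `p`.
pair-≤ : ∀ {n m a b} (p : Subset n) → 1F ∈ a ∷ b ∷ p ⊎ 0F ∈ a ∷ b ∷ p →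
         m ℕ.≤ ∣ p ∣ → suc m ℕ.≤ ∣ a ∷ b ∷ p ∣
pair-≤ {a = inside}  {inside}  _ _ m≤p = s≤s (ℕ.m≤n⇒m≤1+n m≤p)
pair-≤ {a = inside}  {outside} _ _ m≤p = s≤s m≤p
pair-≤ {a = outside} {inside}  _ _ m≤p = s≤s m≤p
pair-≤ {a = outside} {outside} _ (inj₁ (there ())) _
pair-≤ {a = outside} {outside} _ (inj₂ ()) _

-- The ordering of a block puts the matching edges ux, vy and ba on consecutive positions, so
-- `pair-≤` peels them off in turn: three per full block, two in the last.
coversParents⇒≤ : ∀ k X → CoversParents k X → 2 + k * 3 ℕ.≤ ∣ X ∣
coversParents⇒≤ zero (a ∷ b ∷ X@(_ ∷ _ ∷ Y)) covers =
  pair-≤ X (covers 1F λ ())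
  (pair-≤ Y (map-⊎ drop₂ drop₂ (covers 3F λ ())) z≤n)
  where
  drop₂ : ∀ {i} → suc (suc i) ∈ a ∷ b ∷ X → i ∈ X
  drop₂ = drop-there ∘ drop-there
coversParents⇒≤ (suc k) (a ∷ b ∷ X@(c ∷ d ∷ Y@(_ ∷ _ ∷ Z))) covers =
  pair-≤ X (covers 1F λ ())
  (pair-≤ Y (map-⊎ drop₂ drop₂ (covers 3F λ ()))
  (pair-≤ Z (map-⊎ drop₄ drop₄ (covers 5F λ ()))
  (coversParents⇒≤ k Z rest)))
  where
  drop₂ : ∀ {i} → suc (suc i) ∈ a ∷ b ∷ X → i ∈ X
  drop₂ = drop-there ∘ drop-there

  drop₄ : ∀ {i} → 4 ↑ʳ i ∈ a ∷ b ∷ X → i ∈ Y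
  drop₄ = drop-there ∘ drop-there ∘ drop₂

  -- The edge from a to the next u is dropped: that u is the root of the remaining chain, which
  -- `CoversParents` exempts.
  rest : CoversParents k Z
  rest zero    v≢0 = ⊥-elim (v≢0 refl)
  rest (suc v) _   = map-⊎ unshift-∈ unshift-∈ (covers (6 ↑ʳ suc v) λ ())

τ-isMinimum : ∀ k → IsMinimumCardinality (IsVertexCover (T k)) (2 + k * 3)
τ-isMinimum k =
  (cover k , coversParents⇒isVertexCover k (cover-coversParents k) , ∣cover∣ k) ,
  λ X covers → coversParents⇒≤ k X (isVertexCover⇒coversParents k covers)

-- The total domination number

-- Members of `supports k` get a neighbour too, as u and v of a block serve each other; this gives
-- both halves of total domination at once.
supports-dominate : ∀ k v → ∃[ u ] (u ∈ supports k × _~_ (T k) v u)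
supports-dominate k       0F = 2F , v∈blocks outside k , inj₂ (refl , ℕ.m≤m+n 1 1)
supports-dominate k       1F = 0F , u∈blocks outside k , child k 1F λ ()
supports-dominate k       2F = 0F , u∈blocks outside k , child k 2F λ ()
supports-dominate k       3F = 2F , v∈blocks outside k , child k 3F λ ()
supports-dominate (suc k) 4F = 0F , here , child (suc k) 4F λ ()
-- The parent b of a is outside `supports`, so a relies on its child, the next u.
supports-dominate (suc k) 5F =
  6F , shift-∈ (u∈blocks outside k) , inj₂ (refl , ℕ.≤-refl)
-- This includes the next u, at `6F`, which finds v in its own block.
supports-dominate (suc k) (suc (suc (suc (suc (suc (suc v)))))) =
  let u , u∈supports , v~u = supports-dominate k v
  in 6 ↑ʳ u , shift-∈ u∈supports , shift-~ k v~u

supports-isTotalDominating : ∀ k → IsTotalDominating (T k) (supports k)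
supports-isTotalDominating k =
  (λ v → inj₂ (supports-dominate k v)) , λ v _ → supports-dominate k v

-- The root is a fixed point of `parent` and so fails this; a childless vertex is therefore a
-- genuine leaf.
Childless : ∀ k → Vertex (T k) → Set
Childless k ℓ = ∀ w → parent k w ≢ ℓ

childless-neighbour : ∀ k {ℓ} → Childless k ℓ → ∀ {w} → _~_ (T k) ℓ w → w ≡ parent k ℓ
childless-neighbour k childless     (inj₁ (ℓ→w , _)) = sym ℓ→w
childless-neighbour k childless {w} (inj₂ (w→ℓ , _)) = ⊥-elim (childless w w→ℓ)

x-childless : ∀ k → Childless k 1F
x-childless k       0F ()
x-childless k       1F ()
x-childless k       2F ()
x-childless k       3F ()
x-childless (suc k) 4F ()
x-childless (suc k) 5F ()
x-childless (suc k) 6F ()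
x-childless (suc k) (suc (suc (suc (suc (suc (suc (suc w))))))) ()

y-childless : ∀ k → Childless k 3F
y-childless k       0F ()
y-childless k       1F ()
y-childless k       2F ()
y-childless k       3F ()
y-childless (suc k) 4F ()
y-childless (suc k) 5F ()
y-childless (suc k) 6F ()
y-childless (suc k) (suc (suc (suc (suc (suc (suc (suc w))))))) ()

shift-childless : ∀ k {ℓ} → Childless k ℓ → Childless (suc k) (6 ↑ʳ ℓ)
shift-childless k childless 0F ()
shift-childless k childless 1F ()
shift-childless k childless 2F ()
shift-childless k childless 3F ()
shift-childless k childless 4F ()
shift-childless k childless 5F ()
shift-childless k childless 6F ()
shift-childless k childless (suc (suc (suc (suc (suc (suc (suc w))))))) eq =
  childless (suc w) (Fin.↑ʳ-injective 6 _ _ eq)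

-- The witness is x for u and y for v; the linking paths attach only at u, so both stay leaves.
supported-leaf : ∀ k {s} → s ∈ supports k → ∃[ ℓ ] (parent k ℓ ≡ s × Childless k ℓ)
supported-leaf k       {0F} _ = 1F , refl , x-childless k
supported-leaf zero    {1F} (there ())
supported-leaf (suc k) {1F} (there ())
supported-leaf k       {2F} _ = 3F , refl , y-childless k
supported-leaf zero    {3F} (there (there (there ())))
supported-leaf (suc k) {3F} (there (there (there ())))
supported-leaf (suc k) {4F} (there (there (there (there ()))))
supported-leaf (suc k) {5F} (there (there (there (there (there ())))))
supported-leaf (suc k) {suc (suc (suc (suc (suc (suc s)))))} s∈supports
  with supported-leaf k (unshift-∈ s∈supports)
-- Only non-root vertices keep their parent under the shift, so the leaf must not be the root; the
-- root is its own parent, hence not childless.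
... | zero  , _   , childless = ⊥-elim (childless 0F refl)
... | suc ℓ , ℓ→s , childless =
  6 ↑ʳ suc ℓ , cong (6 ↑ʳ_) ℓ→s , shift-childless k childless

totalDominating-neighbour : ∀ G {D} → IsTotalDominating G D →
                            ∀ v → ∃[ u ] (u ∈ D × _~_ G v u)
totalDominating-neighbour G (dominating , noIsolated) v = [ noIsolated v , id ] (dominating v)

-- A leaf's only possible neighbour in `D` is its support vertex, which is thereby forced. So
-- `supports k` is least under inclusion, not merely in cardinality.
supports⊆ : ∀ k {D} → IsTotalDominating (T k) D → supports k ⊆ D
supports⊆ k {D} total s∈supports
  with ℓ , refl , childless ← supported-leaf k s∈supports
  with u , u∈D , ℓ~u ← totalDominating-neighbour (T k) total ℓ =
  subst (_∈ D) (childless-neighbour k childless ℓ~u) u∈D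

γₜ-isMinimum : ∀ k → IsMinimumCardinality (IsTotalDominating (T k)) (2 + k * 2)
γₜ-isMinimum k =
  (supports k , supports-isTotalDominating k , ∣supports∣ k) ,
  λ D total → subst (ℕ._≤ ∣ D ∣) (∣supports∣ k) (p⊆q⇒∣p∣≤∣q∣ (supports⊆ k total))

-- Values of `τ` and `γₜ`, and their difference

-- `τ` and `γₜ` result from a search that does not evaluate for a variable `k`; uniqueness of the
-- minimum identifies them with explicit numbers.
minimum-unique : ∀ {n} {P : Pred (Subset n) 0ℓ} {m m′} →
                 IsMinimumCardinality P m → IsMinimumCardinality P m′ → m ≡ m′
minimum-unique ((X , pX , refl) , X-min) ((Y , pY , refl) , Y-min) =
  ℕ.≤-antisym (X-min Y pY) (Y-min X pX)

T-noIsolated : ∀ k → NoIsolatedVertices (T k)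
T-noIsolated k v with u , _ , v~u ← supports-dominate k v = u , v~u

τ-T : ∀ k → τ (T k) ≡ 2 + k * 3
τ-T k = minimum-unique (proj₂ (τ-minimum (T k))) (τ-isMinimum k)

γₜ-T : ∀ k ni → γₜ (T k) ni ≡ 2 + k * 2
γₜ-T k ni = minimum-unique (proj₂ (γₜ-minimum (T k) ni)) (γₜ-isMinimum k)

difference : ∀ k → + (2 + k * 3) - + (2 + k * 2) ≡ + k
difference k = begin
  + (2 + k * 3) - + (2 + k * 2)  ≡⟨ ℤ.m-n≡m⊖n (2 + k * 3) (2 + k * 2) ⟩
  -- The common summand 2 cancels in `∸` by computation.
  (2 + k * 3) ⊖ (2 + k * 2)      ≡⟨ ℤ.⊖-≥ (ℕ.+-monoʳ-≤ 2 (ℕ.*-monoʳ-≤ k (ℕ.n≤1+n 2))) ⟩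
  + (k * 3 ∸ k * 2)              ≡⟨ cong +_ (ℕ.*-distribˡ-∸ k 3 2) ⟨
  + (k * 1)                      ≡⟨ cong +_ (ℕ.*-identityʳ k) ⟩
  + k                            ∎
  where open ≡-Reasoning

proposition1 : ∀ (k : ℕ) → 0 < k →
    Σ[ T ∈ Graph ] (Graph.IsTree T ×
    (Σ[ ni ∈ Graph.NoIsolatedVertices T ] (+ τ T - + γₜ T ni ≡ + k)))
proposition1 k _ = T k , T-isTree k , ni ,
  trans (cong₂ (λ m n → + m - + n) (τ-T k) (γₜ-T k ni)) (difference k)
  where ni = T-noIsolated k
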